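{- For every integer $n\ge 1$, $\delta_P(n)=2C(n)-n$.
   Context: $\mathcal{T}_\infty$ is the infinite binary tree with all leaves at the same level: its vertices are the pairs $(i,j)$ of integers with $i\ge 1$, $j\ge 0$; the vertex $(i,j)$ has parent $(i+1,\lfloor j/2\rfloor)$, and the edges join each vertex to its parent. For a finite vertex set $S$, $\overline S$ is its complement and $(S,\overline S)$ is the set of edges with one end in $S$ and the other in $\overline S$. $\delta_P(n)$ is the minimum of $|(S,\overline S)|$ over all $S\subset V(\mathcal{T}_\infty)$ with $|S|=n$ such that $\overline S$ induces a connected subgraph. Conolly sequence: $C(1)=1$, $C(2)=2$ and $C(n)=C(n-C(n-1))+C(n-1-C(n-2))$ for $n>2$. -}

module Defs where

open import Level using (Level; 0ℓ)
open import Data.Nat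
open import Data.Nat.Properties
open import Data.List using (List; length)
open import Data.List.Membership.Propositional using () renaming (_∈_ to _∈ₗ_)
open import Data.List.Relation.Unary.Unique.Propositional using (Unique)
open import Data.Product using (∃; ∃-syntax; _×_; _,_; proj₁; proj₂)
open import Data.Sum using (_⊎_; inj₁; inj₂)
open import Function.Bundles using (_⇔_)
open import Relation.Binary.Core using (Rel)
open import Relation.Binary.Construct.Closure.ReflexiveTransitive using (Star)
open import Relation.Binary.Construct.Closure.Symmetric using (SymClosure)
open import Relation.Binary.PropositionalEquality
open import Relation.Unary using (Pred; _∈_; ∁)

private
  variable
    a ℓ : Level
    A : Set a

HasSize : {A : Set a} → Pred A ℓ → ℕ → Set _
HasSize P k = ∃[ xs ] Unique xs × length xs ≡ k × (∀ x → x ∈ₗ xs ⇔ x ∈ P)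

IsMinimum : Pred ℕ ℓ → Pred ℕ ℓ
IsMinimum P m = P m × (∀ k → P k → m ≤ k)

record Vertex : Set where
  constructor vertex
  field
    level index : ℕ
    .{{level≥1}} : NonZero level

parent : Vertex → Vertex
parent (vertex i j) = vertex (suc i) ⌊ j /2⌋

Adjacent : Rel Vertex 0ℓ
Adjacent = SymClosure (λ u v → v ≡ parent u)

-- An edge of (S , ∁ S) is recorded as the ordered pair of its ends whose first
-- component is the end in S, so every such edge is counted exactly once.
EdgeCut : Pred Vertex 0ℓ → Pred (Vertex × Vertex) 0ℓ
EdgeCut S (u , v) = u ∈ S × v ∈ ∁ S × Adjacent u v

InducesConnected : Pred Vertex 0ℓ → Set
InducesConnected T =
  ∀ u v → u ∈ T → v ∈ T → Star (λ x y → x ∈ T × y ∈ T × Adjacent x y) u v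

-- IsδP n m says that m is the value of δ_P(n).  It is a relation because the
-- minimum ranges over infinitely many sets S; the value is unique by ≤-antisym.
IsδP : ℕ → ℕ → Set₁
IsδP n = IsMinimum λ k →
  ∃[ S ] HasSize S n × InducesConnected (∁ S) × HasSize (EdgeCut S) k

-- The recurrence is nested, hence the fuel; n units suffice to compute C n.
-- C-rec and C-bounds below show that C is the Conolly sequence on n ≥ 1 and that
-- no subtraction in the recurrence is truncated.  The value at 0 is arbitrary.
conolly : (fuel n : ℕ) → ℕ
conolly zero       _ = 1
conolly (suc fuel) 0 = 1
conolly (suc fuel) 1 = 1
conolly (suc fuel) 2 = 2
conolly (suc fuel) n@(suc (suc (suc _))) =
  conolly fuel (n ∸ conolly fuel (n ∸ 1)) +
  conolly fuel (n ∸ 1 ∸ conolly fuel (n ∸ 2))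

C : ℕ → ℕ
C n = conolly n n

private
  conolly≥1 : ∀ k n → 1 ≤ conolly k n
  conolly≥1 zero    _ = ≤-refl
  conolly≥1 (suc k) 0 = ≤-refl
  conolly≥1 (suc k) 1 = ≤-refl
  conolly≥1 (suc k) 2 = s≤s z≤n
  conolly≥1 (suc k) (suc (suc (suc n))) = m≤n⇒m≤n+o _ (conolly≥1 k _)

  suc∸≤ : ∀ n {c} → 1 ≤ c → suc n ∸ c ≤ n
  suc∸≤ n {suc c} _ = m∸n≤m n c

  conolly-step : ∀ k n → n ≤ k → conolly (suc k) n ≡ conolly k n
  conolly-step zero    0 _ = refl
  conolly-step (suc k) 0 _ = refl
  conolly-step (suc k) 1 _ = refl
  conolly-step (suc k) 2 _ = refl
  conolly-step (suc k) (suc (suc (suc n))) (s≤s n+2≤k)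
    rewrite conolly-step k (suc (suc n)) n+2≤k
          | conolly-step k (suc n) (≤-trans (n≤1+n _) n+2≤k)
    = cong₂ _+_
        (conolly-step k _ (≤-trans (suc∸≤ (suc (suc n)) (conolly≥1 k _)) n+2≤k))
        (conolly-step k _ (≤-trans (suc∸≤ (suc n) (conolly≥1 k _))
                                   (≤-trans (n≤1+n _) n+2≤k)))

  conolly≡C : ∀ {k n} → n ≤′ k → conolly k n ≡ C n
  conolly≡C (≤′-reflexive refl) = refl
  conolly≡C (≤′-step n≤k) =
    trans (conolly-step _ _ (≤′⇒≤ n≤k)) (conolly≡C n≤k)

C≥1 : ∀ n → 1 ≤ C n
C≥1 n = conolly≥1 n n

C-rec : ∀ n → 2 < n → C n ≡ C (n ∸ C (n ∸ 1)) + C (n ∸ 1 ∸ C (n ∸ 2))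
C-rec (suc (suc (suc n))) _
  rewrite conolly-step (suc n) (suc n) ≤-refl
  = cong₂ _+_
      (conolly≡C (≤⇒≤′ (suc∸≤ (suc (suc n)) (C≥1 (suc (suc n))))))
      (conolly≡C (≤⇒≤′ (≤-trans (suc∸≤ (suc n) (C≥1 (suc n))) (n≤1+n _))))
C-rec (suc (suc zero)) (s≤s (s≤s ()))
C-rec (suc zero) (s≤s ())

private
  Step : (ℕ → ℕ) → ℕ → Set
  Step f n = f (suc n) ≡ f n ⊎ f (suc n) ≡ suc (f n)

  d : ℕ → ℕ
  d n = suc n ∸ C n

  C-rec′ : ∀ n → C (2 + n) ≡ C (d (suc n)) + C (d n)
  C-rec′ zero    = refl
  C-rec′ (suc n) = C-rec (3 + n) (s≤s (s≤s (s≤s z≤n)))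

  d≤ : ∀ n → d n ≤ n
  d≤ n = suc∸≤ n (C≥1 n)

  C≤ : ∀ n → (∀ m → m < n → Step C m) → C n ≤ suc n
  C≤ zero    _ = ≤-refl
  C≤ (suc n) s with s n ≤-refl | C≤ n (λ m m<n → s m (m<n⇒m<1+n m<n))
  ... | inj₁ e | h rewrite e = m≤n⇒m≤1+n h
  ... | inj₂ e | h rewrite e = s≤s h

  d-step : ∀ n → (∀ m → m ≤ n → Step C m) →
           (C (suc n) ≡ C n × d (suc n) ≡ suc (d n)) ⊎ d (suc n) ≡ d n
  d-step n s with s n ≤-refl
  ... | inj₁ e rewrite e = inj₁ (refl , +-∸-assoc 1 (C≤ n (λ m m<n → s m (<⇒≤ m<n))))
  ... | inj₂ e rewrite e = inj₂ refl

  Step⇒≤ : ∀ {f : ℕ → ℕ} {n} → Step f n → f n ≤ f (suc n)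
  Step⇒≤ (inj₁ e) = ≤-reflexive (sym e)
  Step⇒≤ (inj₂ e) = ≤-trans (n≤1+n _) (≤-reflexive (sym e))

  lift : ∀ {x y z} → x ≡ y ⊎ x ≡ suc y → x + z ≡ z + y ⊎ x + z ≡ suc (z + y)
  lift {y = y} {z} (inj₁ e) rewrite e = inj₁ (+-comm y z)
  lift {y = y} {z} (inj₂ e) rewrite e = inj₂ (cong suc (+-comm y z))

  C-step : ∀ n m → m ≤ n → Step C m
  C-step _ 0 _ = inj₁ refl
  C-step _ 1 _ = inj₂ refl
  C-step _ 2 _ = inj₁ refl
  C-step (suc n) (suc (suc (suc p))) (s≤s p+2≤n) =
    subst₂ (λ x y → x ≡ y ⊎ x ≡ suc y)
      (sym (C-rec′ (2 + p))) (sym (C-rec′ (1 + p))) (lift gap)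
    where
    IH : ∀ m → m ≤ 2 + p → Step C m
    IH m m≤ = C-step n m (≤-trans m≤ p+2≤n)

    IHd : ∀ m → m ≤ 2 + p → Step C (d m)
    IHd m m≤ = IH (d m) (≤-trans (d≤ m) m≤)

    mono : ∀ m → m ≤ 1 + p → C (d m) ≤ C (d (suc m))
    mono m m≤ with d-step m (λ k k≤ → IH k (≤-trans k≤ (m≤n⇒m≤1+n m≤)))
    ... | inj₁ (_ , e) rewrite e = Step⇒≤ {C} {d m} (IHd m (m≤n⇒m≤1+n m≤))
    ... | inj₂ e rewrite e = ≤-refl

    flat : C (3 + p) ≡ C (2 + p) → C (d (2 + p)) ≡ C (d (1 + p))
    flat e = ≤-antisym
      (≤-trans (≤-reflexive (+-cancelʳ-≡ (C (d (1 + p))) _ _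
                 (trans (sym (C-rec′ (1 + p)))
                   (trans e (trans (C-rec′ p) (+-comm (C (d (1 + p))) _))))))
               (mono p (n≤1+n p)))
      (mono (1 + p) ≤-refl)

    gap : C (d (3 + p)) ≡ C (d (1 + p)) ⊎ C (d (3 + p)) ≡ suc (C (d (1 + p)))
    gap with d-step (2 + p) IH
           | d-step (1 + p) (λ k k≤ → IH k (m≤n⇒m≤1+n k≤))
           | IHd (1 + p) (n≤1+n (1 + p))
    ... | inj₂ e₁ | inj₂ e₂ | _ = inj₁ (cong C (trans e₁ e₂))
    ... | inj₂ e₁ | inj₁ (_ , e₂) | s rewrite trans e₁ e₂ = s
    ... | inj₁ (_ , e₁) | inj₂ e₂ | s rewrite trans e₁ (cong suc e₂) = s
    ... | inj₁ (e , e₁) | inj₁ _ | _ rewrite e₁ | sym (flat e) = IHd (2 + p) ≤-refl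

C-bounds : ∀ n → 1 ≤ n → 1 ≤ C n × C n ≤ n
C-bounds n n≥1 = C≥1 n , upper n n≥1
  where
  upper : ∀ n → 1 ≤ n → C n ≤ n
  upper 1 _ = ≤-refl
  upper (suc (suc n)) _ with C-step (suc n) (suc n) ≤-refl | upper (suc n) (s≤s z≤n)
  ... | inj₁ e | h rewrite e = m≤n⇒m≤1+n h
  ... | inj₂ e | h rewrite e = s≤s h

{-# OPTIONS --safe #-}

-- If the complement of a finite set S is connected then S is closed under
-- taking children: both subtrees below a vertex of S are cut off from the
-- infinite part of the tree.  Conversely the complement of a child-closed set
-- is closed under parents, hence connected.  For a child-closed S with n
-- vertices, ℓ of them leaves, every vertex of S is either an end of a cut edge
-- or one of the 2(n − ℓ) children of the non-leaves, so |(S, S̄)| = 2ℓ − n.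
-- Level i + 1 of S has at most half as many vertices as level i, so
-- n ≤ M ℓ = ℓ + ⌊ℓ/2⌋ + ⌊ℓ/4⌋ + …, and initial segments of the levels realise
-- every n with ℓ ≤ n ≤ M ℓ.  Finally C n is the least ℓ with n ≤ M ℓ, by strong
-- induction from M ℓ = ℓ + M ⌊ℓ/2⌋.
module Submission where

open import Defs
open import Data.Nat using (ℕ; _≥_)
open import Data.Integer using (+_; _*_; _-_)
open import Data.Product using (∃-syntax; _×_)
open import Relation.Binary.PropositionalEquality using (_≡_)

open import Data.Integer using (_⊖_)
open import Data.Integer.Properties using (m-n≡m⊖n; ⊖-≥; pos-*)
open import Data.List using (List; []; _∷_; _++_; length; map; filter; concatMap; upTo)
open import Data.List.Extrema.Nat using (max; xs≤max)
open import Data.List.Membership.Propositional using (_∈_; _∉_)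
open import Data.List.Membership.Propositional.Properties
  using (∈-++⁺ˡ; ∈-++⁺ʳ; ∈-++⁻; ∈-map⁺; ∈-map⁻; ∈-filter⁺; ∈-filter⁻; ∈-∃++;
         ∈-upTo⁺; ∈-upTo⁻)
import Data.List.Membership.DecPropositional as DecMembership
open import Data.List.Properties
  using (length-++; length-map; length-upTo; filter-none)
open import Data.List.Relation.Binary.Subset.Propositional using (_⊆_)
open import Data.List.Relation.Unary.All using (lookup; tabulate; []; _∷_)
open import Data.List.Relation.Unary.Any using (here; there)
open import Data.List.Relation.Unary.AllPairs using ([]; _∷_)
open import Data.List.Relation.Unary.Unique.Propositional using (Unique)
open import Data.List.Relation.Unary.Unique.Propositional.Properties
  using (Unique[x∷xs]⇒x∉xs; map⁺; ++⁺; filter⁺; upTo⁺)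
open import Data.Nat using (zero; suc; _+_; _∸_; _≤_; _<_; _⊓_; _≟_; _≤?_; _≤′_;
  ≤′-refl; ≤′-step; z≤n; s≤s; ⌊_/2⌋; ⌈_/2⌉;
  ≢-nonZero⁻¹; >-nonZero⁻¹)
open import Data.Nat.Induction using (<-rec)
open import Data.Nat.Properties
open import Data.Nat.Tactic.RingSolver using (solve-∀)
open import Data.Product using (_,_; proj₁; proj₂)
open import Data.Sum using (_⊎_; inj₁; inj₂)
open import Function.Base using (_∘_)
open import Function.Bundles using (_⇔_; mk⇔; Equivalence)
open import Level using (Level; 0ℓ)
open import Relation.Binary.Construct.Closure.ReflexiveTransitive
  using (Star; ε; _◅_; _◅◅_; reverse)
open import Relation.Binary.Construct.Closure.Symmetric using (fwd; bwd; symmetric)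
open import Relation.Binary.Definitions using (DecidableEquality)
open import Relation.Binary.PropositionalEquality
  using (refl; sym; trans; cong; cong₂; subst; module ≡-Reasoning)
open import Relation.Nullary using (¬_; yes; no; ¬?; contradiction)
open import Relation.Unary using (Pred; ∁)

open Equivalence using (to; from)

private
  variable
    a ℓ : Level
    A : Set a

-- Sums of iterated halves

-- The most vertices that a child-closed set with l leaves can have in levels 1 to f.
vertices : (f l : ℕ) → ℕ
vertices zero    l = 0
vertices (suc f) l = l + vertices f ⌊ l /2⌋

M : ℕ → ℕ
M l = vertices l l

n≤1+m⇒⌊n/2⌋≤m : ∀ {m n} → n ≤ suc m → ⌊ n /2⌋ ≤ m
n≤1+m⇒⌊n/2⌋≤m {n = zero}  _         = z≤n
n≤1+m⇒⌊n/2⌋≤m {n = suc n} (s≤s n≤m) = ≤-trans (⌈n/2⌉≤n n) n≤m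

vertices-step : ∀ f l → l ≤ f → vertices (suc f) l ≡ vertices f l
vertices-step zero    zero    _ = refl
vertices-step (suc f) l l≤1+f = cong (_+_ l) (vertices-step f ⌊ l /2⌋ (n≤1+m⇒⌊n/2⌋≤m l≤1+f))

vertices≡M : ∀ {f l} → l ≤′ f → vertices f l ≡ M l
vertices≡M ≤′-refl = refl
vertices≡M (≤′-step l≤f) = trans (vertices-step _ _ (≤′⇒≤ l≤f)) (vertices≡M l≤f)

M-rec : ∀ l → M l ≡ l + M ⌊ l /2⌋
M-rec zero    = refl
M-rec (suc l) = cong (_+_ (suc l)) (vertices≡M (≤⇒≤′ (⌈n/2⌉≤n l)))

vertices-mono : ∀ f {k l} → k ≤ l → vertices f k ≤ vertices f l
vertices-mono zero    _   = z≤n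
vertices-mono (suc f) k≤l = +-mono-≤ k≤l (vertices-mono f (⌊n/2⌋-mono k≤l))

M<M∘suc : ∀ l → M l < M (suc l)
-- `M l` is read with one more level, so that both sums have equally many terms and compare
-- termwise, strictly in the first.
M<M∘suc l = subst (_< M (suc l)) (vertices-step l l ≤-refl)
  (+-mono-<-≤ (n<1+n l) (vertices-mono l (⌊n/2⌋-mono (n≤1+n l))))

M-mono′ : ∀ {k l} → k ≤′ l → M k ≤ M l
M-mono′ ≤′-refl = ≤-refl
M-mono′ (≤′-step {l} k≤l) = ≤-trans (M-mono′ k≤l) (<⇒≤ (M<M∘suc l))

M-mono : ∀ {k l} → k ≤ l → M k ≤ M l
M-mono = M-mono′ ∘ ≤⇒≤′

vertices≤M : ∀ f l → vertices f l ≤ M l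
vertices≤M zero    l = z≤n
vertices≤M (suc f) l =
  subst (l + vertices f ⌊ l /2⌋ ≤_) (sym (M-rec l)) (+-monoʳ-≤ l (vertices≤M f ⌊ l /2⌋))

-- The Conolly sequence as the inverse of `M`

LeastLeaves : ℕ → ℕ → Set
LeastLeaves n = IsMinimum (λ l → n ≤ M l)

leastLeaves-unique : ∀ {n k l} → LeastLeaves n k → LeastLeaves n l → k ≡ l
leastLeaves-unique (n≤Mk , k-least) (n≤Ml , l-least) =
  ≤-antisym (k-least _ n≤Ml) (l-least _ n≤Mk)

M∸-half : ∀ l → M l ∸ l ≡ M ⌊ l /2⌋
M∸-half l = trans (cong (_∸ l) (M-rec l)) (m+n∸m≡n l _)

-- The recurrence adds `⌈ m /2⌉`, the least count for `suc n ∸ l`, to the same term one index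
-- earlier, which is `⌈ l /2⌉`. Either `l` leaves still suffice for `suc n`, and then `l` is even,
-- or `n ≡ M l` and `m` is `suc l`.
leastLeaves-step : ∀ {n l} → LeastLeaves n l →
  ∃[ m ] LeastLeaves (suc n) m × LeastLeaves (suc n ∸ l) ⌈ m /2⌉ × ⌈ m /2⌉ + ⌈ l /2⌉ ≡ m
leastLeaves-step {n} {l} (n≤Ml , l-least) with suc n ≤? M l
... | yes n<Ml =
  l , (n<Ml , λ k n<Mk → l-least k (<⇒≤ n<Mk)) , (below-⌈⌉ , ⌈⌉-least l l-least) , even
  where
  below : suc n ∸ l ≤ M ⌊ l /2⌋
  below = ≤-trans (∸-monoˡ-≤ l n<Ml) (≤-reflexive (M∸-half l))

  below-⌈⌉ : suc n ∸ l ≤ M ⌈ l /2⌉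
  below-⌈⌉ = ≤-trans below (M-mono (⌊n/2⌋≤⌈n/2⌉ l))

  ⌈⌉-least : ∀ l → (∀ k → n ≤ M k → l ≤ k) → ∀ k → suc n ∸ l ≤ M k → ⌈ l /2⌉ ≤ k
  ⌈⌉-least zero    _       k _ = z≤n
  -- The least count is now `suc l`. Some `k ≤ ⌊ l /2⌋` would give `n ≤ l + M ⌊ l /2⌋`, which is
  -- `M l`.
  ⌈⌉-least (suc l) l-least k h = ≮⇒≥ λ { (s≤s k≤l/2) →
    1+n≰n (l-least l (≤-trans (m∸n≤o⇒m≤n+o n l h)
      (≤-trans (+-monoʳ-≤ l (M-mono k≤l/2)) (≤-reflexive (sym (M-rec l)))))) }
    where
    m∸n≤o⇒m≤n+o : ∀ m n {o} → m ∸ n ≤ o → m ≤ n + o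
    m∸n≤o⇒m≤n+o m n m∸n≤o = ≤-trans (m≤n+m∸n m n) (+-monoʳ-≤ n m∸n≤o)

  even : ⌈ l /2⌉ + ⌈ l /2⌉ ≡ l
  -- `⌊ l /2⌋` already meets the bound for which `⌈ l /2⌉` is least, so the two halves agree.
  even = trans (cong (_+ ⌈ l /2⌉) (≤-antisym (⌈⌉-least l l-least _ below) (⌊n/2⌋≤⌈n/2⌉ l)))
               (⌊n/2⌋+⌈n/2⌉≡n l)
... | no n≮Ml =
  suc l , (top , suc-least) , (half-top , half-least) , cong suc (⌊n/2⌋+⌈n/2⌉≡n l)
  where
  n≡Ml : n ≡ M l
  n≡Ml = ≤-antisym n≤Ml (≮⇒≥ n≮Ml)

  top : suc n ≤ M (suc l)
  top = subst (λ x → suc x ≤ M (suc l)) (sym n≡Ml) (M<M∘suc l)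

  suc-least : ∀ k → suc n ≤ M k → suc l ≤ k
  suc-least k n<Mk = ≰⇒> λ k≤l → n≮Ml (≤-trans n<Mk (M-mono k≤l))

  l≤Ml : l ≤ M l
  l≤Ml = ≤-trans (m≤m+n l _) (≤-reflexive (sym (M-rec l)))

  half≡ : suc n ∸ l ≡ suc (M ⌊ l /2⌋)
  half≡ = trans (cong (λ x → suc x ∸ l) n≡Ml)
    (trans (+-∸-assoc 1 l≤Ml) (cong suc (M∸-half l)))

  half-top : suc n ∸ l ≤ M (suc ⌊ l /2⌋)
  half-top = subst (_≤ M (suc ⌊ l /2⌋)) (sym half≡) (M<M∘suc ⌊ l /2⌋)

  half-least : ∀ k → suc n ∸ l ≤ M k → suc ⌊ l /2⌋ ≤ k
  half-least k h = ≰⇒> λ k≤ →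
    1+n≰n (≤-trans (subst (_≤ M k) half≡ h) (M-mono k≤))

C-leastLeaves : ∀ n → 1 ≤ n → LeastLeaves n (C n)
C-leastLeaves = <-rec _ go
  where
  go : ∀ n → (∀ {m} → m < n → 1 ≤ m → LeastLeaves m (C m)) → 1 ≤ n → LeastLeaves n (C n)
  go 1 _ _ = ≤-refl , λ { zero () ; (suc k) _ → s≤s z≤n }
  go 2 _ _ = s≤s (s≤s z≤n) , λ { zero () ; 1 (s≤s ()) ; (suc (suc k)) _ → s≤s (s≤s z≤n) }
  go (suc (suc (suc n))) IH _
    with at₂ ← IH {2 + n} ≤-refl (s≤s z≤n)
    with leastLeaves-step at₂ | leastLeaves-step (IH {1 + n} (n≤1+n _) (s≤s z≤n))
  ... | m , at₃ , half₃ , m≡ | k , at₂′ , half₂ , _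
      -- `k` is the least count for `2 + n`, hence `C (2 + n)`; thus `half₂` evaluates the second
      -- summand of the recurrence.
      with refl ← leastLeaves-unique at₂′ at₂ =
      subst (LeastLeaves (3 + n)) (sym C≡m) at₃
    where
    delay : ∀ n {l} → LeastLeaves (2 + n ∸ C (1 + n)) l →
            (∀ {m} → m < 2 + n → 1 ≤ m → LeastLeaves m (C m)) →
            C (2 + n ∸ C (1 + n)) ≡ l
    delay n least IH = leastLeaves-unique
      (IH (s≤s (suc∸≤ (suc n) (C≥1 (suc n))))
          (m<n⇒0<n∸m (s≤s (proj₂ (C-bounds (suc n) (s≤s z≤n)))))) least
      where
      suc∸≤ : ∀ n {c} → 1 ≤ c → suc n ∸ c ≤ n
      suc∸≤ n {suc c} _ = m∸n≤m n c

    C≡m : C (3 + n) ≡ m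
    C≡m = trans (C-rec (3 + n) (s≤s (s≤s (s≤s z≤n))))
      (trans (cong₂ _+_ (delay (suc n) half₃ IH)
                        (delay n half₂ (λ m< → IH (m<n⇒m<1+n m<)))) m≡)

-- Counting with duplicate-free lists

-- Delete one occurrence of the head of `xs` from `ys` and recurse: by uniqueness the tail of `xs`
-- never asks for it again.
⊆⇒length≤ : {xs ys : List A} → Unique xs → xs ⊆ ys → length xs ≤ length ys
⊆⇒length≤ {xs = []} _ _ = z≤n
⊆⇒length≤ {xs = x ∷ xs} {ys} xs!@(_ ∷ xs!′) xs⊆ys with ∈-∃++ (xs⊆ys (here refl))
... | as , bs , refl = ≤-trans (s≤s (⊆⇒length≤ xs!′ xs⊆as++bs)) (≤-reflexive length≡)
  where
  xs⊆as++bs : xs ⊆ as ++ bs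
  xs⊆as++bs v∈xs with ∈-++⁻ as (xs⊆ys (there v∈xs))
  ... | inj₁ v∈as         = ∈-++⁺ˡ v∈as
  ... | inj₂ (here refl)  = contradiction v∈xs (Unique[x∷xs]⇒x∉xs xs!)
  ... | inj₂ (there v∈bs) = ∈-++⁺ʳ as v∈bs

  length≡ : suc (length (as ++ bs)) ≡ length (as ++ x ∷ bs)
  length≡ = trans (cong suc (length-++ as))
    (trans (sym (+-suc (length as) (length bs))) (sym (length-++ as)))

⊆⊇⇒length≡ : {xs ys : List A} → Unique xs → Unique ys → xs ⊆ ys → ys ⊆ xs →
            length xs ≡ length ys
⊆⊇⇒length≡ xs! ys! xs⊆ys ys⊆xs = ≤-antisym (⊆⇒length≤ xs! xs⊆ys) (⊆⇒length≤ ys! ys⊆xs)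

hasSize-unique : {P : Pred A ℓ} → ∀ {k l} → HasSize P k → HasSize P l → k ≡ l
hasSize-unique (xs , xs! , refl , xs⇔P) (ys , ys! , refl , ys⇔P) = ⊆⊇⇒length≡ xs! ys!
  (λ {x} x∈ → from (ys⇔P x) (to (xs⇔P x) x∈)) (λ {x} x∈ → from (xs⇔P x) (to (ys⇔P x) x∈))

-- Children in the tree

open Vertex using (level; index)

_≟ᵥ_ : DecidableEquality Vertex
vertex i j ≟ᵥ vertex i′ j′ with i ≟ i′ | j ≟ j′
... | yes refl | yes refl = yes refl
... | no  i≢i′ | _        = no (i≢i′ ∘ cong level)
... | _        | no j≢j′  = no (j≢j′ ∘ cong index)

open DecMembership _≟ᵥ_ using (_∈?_)

1≤level : ∀ v → 1 ≤ level v
1≤level (vertex i j) = >-nonZero⁻¹ i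

children : Vertex → List Vertex
children (vertex 0 _)             = []
children (vertex 1 _)             = []
children (vertex (suc (suc i)) j) = vertex (suc i) (j + j) ∷ vertex (suc i) (suc (j + j)) ∷ []

∈-children⁻ : ∀ {u} v → u ∈ children v → parent u ≡ v
∈-children⁻ (vertex (suc (suc i)) j) (here refl) = cong (λ k → vertex _ k) (sym (n≡⌊n+n/2⌋ j))
∈-children⁻ (vertex (suc (suc i)) j) (there (here refl)) =
  cong (λ k → vertex _ k) (sym (n≡⌈n+n/2⌉ j))

∈-children-parent : ∀ u → u ∈ children (parent u)
∈-children-parent (vertex zero j {{p}}) = contradiction refl (≢-nonZero⁻¹ 0 {{p}})
∈-children-parent (vertex (suc i) j) with parity j
  where
  parity : ∀ j → j ≡ ⌊ j /2⌋ + ⌊ j /2⌋ ⊎ j ≡ suc (⌊ j /2⌋ + ⌊ j /2⌋)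
  parity 0 = inj₁ refl
  parity 1 = inj₂ refl
  parity (suc (suc j)) with parity j
  ... | inj₁ e = inj₁ (cong suc (trans (cong suc e) (sym (+-suc _ _))))
  ... | inj₂ e = inj₂ (cong (suc ∘ suc) (trans e (sym (+-suc _ _))))
... | inj₁ e = here (cong (λ k → vertex (suc i) k) e)
... | inj₂ e = there (here (cong (λ k → vertex (suc i) k) e))

children-unique : ∀ v → Unique (children v)
children-unique (vertex 0 _) = []
children-unique (vertex 1 _) = []
children-unique (vertex (suc (suc i)) j) =
  ((λ e → m≢1+m+n _ (trans (cong index e) (cong suc (sym (+-identityʳ _))))) ∷ []) ∷ [] ∷ []

∈-concatMap-children⁻ : ∀ {u} xs → u ∈ concatMap children xs → parent u ∈ xs
∈-concatMap-children⁻ (x ∷ xs) u∈ with ∈-++⁻ (children x) u∈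
... | inj₁ u∈x  = here (∈-children⁻ x u∈x)
... | inj₂ u∈xs = there (∈-concatMap-children⁻ xs u∈xs)

∈-concatMap-children⁺ : ∀ {u xs} → parent u ∈ xs → u ∈ concatMap children xs
∈-concatMap-children⁺ {u} (here refl) = ∈-++⁺ˡ (∈-children-parent u)
∈-concatMap-children⁺ {xs = x ∷ _} (there p∈) = ∈-++⁺ʳ (children x) (∈-concatMap-children⁺ p∈)

concatMap-children-unique : ∀ {xs} → Unique xs → Unique (concatMap children xs)
concatMap-children-unique {[]} _ = []
concatMap-children-unique {x ∷ xs} xs!@(_ ∷ xs!′) =
  ++⁺ (children-unique x) (concatMap-children-unique xs!′) λ (u∈x , u∈xs) →
    Unique[x∷xs]⇒x∉xs xs! (subst (_∈ xs) (∈-children⁻ x u∈x) (∈-concatMap-children⁻ xs u∈xs))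

atLevel : ℕ → List Vertex → List Vertex
atLevel i = filter (λ v → level v ≟ i)

-- Each leaf contributes no child and every other vertex two. The additive form avoids truncated
-- subtraction.
length-concatMap-children : ∀ xs → let ls = length (atLevel 1 xs) in
  length (concatMap children xs) + (ls + ls) ≡ length xs + length xs
length-concatMap-children [] = refl
length-concatMap-children (vertex 0 _ {{p}} ∷ xs) = contradiction refl (≢-nonZero⁻¹ 0 {{p}})
length-concatMap-children (vertex 1 _ ∷ xs) = trans (shift (length (concatMap children xs)) _)
  (trans (cong (suc ∘ suc) (length-concatMap-children xs)) (cong suc (sym (+-suc _ _))))
  where
  shift : ∀ c l → c + (suc l + suc l) ≡ suc (suc (c + (l + l)))
  shift = solve-∀
length-concatMap-children (vertex (suc (suc i)) j ∷ xs) =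
  trans (cong (suc ∘ suc) (length-concatMap-children xs)) (cong suc (sym (+-suc _ _)))

-- The edge cut of a child-closed set

ChildClosed : Pred Vertex 0ℓ → Set
ChildClosed S = ∀ v → S (parent v) → S v

-- With `n` vertices, `c` children of them, `k` cut edges and `l` leaves, `partition` gives
-- `n = c + k` and counting children gives `c + 2l = 2n`. Hence `c + (n + k) = c + 2l`, and `c`
-- cancels.
cut-size : ∀ {xs} → Unique xs → ChildClosed (_∈ xs) →
  ∃[ k ] HasSize (EdgeCut (_∈ xs)) k ×
         length xs + k ≡ length (atLevel 1 xs) + length (atLevel 1 xs)
cut-size {xs} xs! closed = length cut ,
  (map edge cut , map⁺ (cong proj₁) cut! , length-map edge cut , λ e → mk⇔ edge⁻ edge⁺) ,
  +-cancelˡ-≡ (length (concatMap children xs)) _ _ (trans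
    (shift (length (concatMap children xs)) (length xs) (length cut))
    (trans (cong (_+_ (length xs)) (sym partition)) (sym (length-concatMap-children xs))))
  where
  cut : List Vertex
  cut = filter (λ u → ¬? (parent u ∈? xs)) xs

  cut! : Unique cut
  cut! = filter⁺ _ xs!

  edge : Vertex → Vertex × Vertex
  edge u = u , parent u

  edge⁻ : ∀ {e} → e ∈ map edge cut → EdgeCut (_∈ xs) e
  edge⁻ e∈ with ∈-map⁻ edge e∈
  ... | u , u∈cut , refl with ∈-filter⁻ (λ u → ¬? (parent u ∈? xs)) {xs = xs} u∈cut
  ... | u∈xs , pu∉xs = u∈xs , pu∉xs , fwd refl

  edge⁺ : ∀ {e} → EdgeCut (_∈ xs) e → e ∈ map edge cut
  edge⁺ (u∈xs , pu∉xs , fwd refl) =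
    ∈-map⁺ edge (∈-filter⁺ (λ u → ¬? (parent u ∈? xs)) u∈xs pu∉xs)
  -- No cut edge leads downwards out of the set, so cut edges correspond to their lower ends.
  edge⁺ {_ , v} (pv∈xs , v∉xs , bwd refl) = contradiction (closed v pv∈xs) v∉xs

  partition : length xs ≡ length (concatMap children xs) + length cut
  partition = trans (⊆⊇⇒length≡ xs! unique split merge) (length-++ (concatMap children xs))
    where
    unique : Unique (concatMap children xs ++ cut)
    unique = ++⁺ (concatMap-children-unique xs!) cut! λ (u∈children , u∈cut) →
      proj₂ (∈-filter⁻ (λ u → ¬? (parent u ∈? xs)) {xs = xs} u∈cut)
        (∈-concatMap-children⁻ xs u∈children)

    split : xs ⊆ concatMap children xs ++ cut
    split {u} u∈xs with parent u ∈? xs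
    ... | yes pu∈xs = ∈-++⁺ˡ (∈-concatMap-children⁺ pu∈xs)
    ... | no  pu∉xs = ∈-++⁺ʳ (concatMap children xs)
                        (∈-filter⁺ (λ u → ¬? (parent u ∈? xs)) u∈xs pu∉xs)

    merge : concatMap children xs ++ cut ⊆ xs
    merge {u} u∈ with ∈-++⁻ (concatMap children xs) u∈
    ... | inj₁ u∈children = closed u (∈-concatMap-children⁻ xs u∈children)
    ... | inj₂ u∈cut      = proj₁ (∈-filter⁻ (λ u → ¬? (parent u ∈? xs)) {xs = xs} u∈cut)

  shift : ∀ c n k → c + (n + k) ≡ n + (c + k)
  shift = solve-∀

-- Bounding a child-closed set by its leaves

length≤M-leaves : ∀ {xs} → Unique xs → ChildClosed (_∈ xs) →
                  length xs ≤ M (length (atLevel 1 xs))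
length≤M-leaves {xs} xs! closed = ≤-trans
  (⊆⇒length≤ xs! λ {v} v∈ → ∈-filter⁺ (λ v → 1 ≤? level v) v∈ (1≤level v))
  (≤-trans (bound height 0 λ v∈ → subst (_ ≤_) (sym (+-identityʳ height)) (level≤height v∈))
           (vertices≤M height _))
  where
  height : ℕ
  height = max 0 (map level xs)

  level≤height : ∀ {v} → v ∈ xs → level v ≤ height
  level≤height v∈ = lookup (xs≤max 0 (map level xs)) (∈-map⁺ level v∈)

  fromLevel : ℕ → List Vertex
  fromLevel i = filter (λ v → i ≤? level v) xs

  split : ∀ i → length (fromLevel i) ≤ length (atLevel i xs) + length (fromLevel (suc i))
  split i = ≤-trans (⊆⇒length≤ (filter⁺ _ xs!) cover) (≤-reflexive (length-++ (atLevel i xs)))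
    where
    cover : fromLevel i ⊆ atLevel i xs ++ fromLevel (suc i)
    cover {v} v∈ with ∈-filter⁻ (λ v → i ≤? level v) {xs = xs} v∈
    ... | v∈xs , i≤v with level v ≟ i
    ... | yes v≡i = ∈-++⁺ˡ (∈-filter⁺ (λ v → level v ≟ i) v∈xs v≡i)
    ... | no  v≢i = ∈-++⁺ʳ (atLevel i xs)
                      (∈-filter⁺ (λ v → suc i ≤? level v) v∈xs (≤∧≢⇒< i≤v (v≢i ∘ sym)))

  halve : ∀ i → length (atLevel (2 + i) xs) ≤ ⌊ length (atLevel (1 + i) xs) /2⌋
  -- Each vertex of level `2 + i` has two children in level `1 + i` of the set, and different
  -- vertices share none.
  halve i = subst (_≤ ⌊ length (atLevel (1 + i) xs) /2⌋) (sym (n≡⌊n+n/2⌋ _))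
    (⌊n/2⌋-mono (subst (_≤ length (atLevel (1 + i) xs)) two-each
      (⊆⇒length≤ (concatMap-children-unique (filter⁺ _ xs!)) below)))
    where
    zs : List Vertex
    zs = atLevel (2 + i) xs

    no-leaves : atLevel 1 zs ≡ []
    no-leaves = filter-none _ (tabulate λ {v} v∈zs v≡1 →
      contradiction (trans (sym v≡1) (proj₂ (∈-filter⁻ (λ v → level v ≟ 2 + i) {xs = xs} v∈zs))) λ ())

    two-each : length (concatMap children zs) ≡ length zs + length zs
    two-each = trans (sym (+-identityʳ _))
      (subst (λ ls → length (concatMap children zs) + (length ls + length ls) ≡ length zs + length zs)
             no-leaves (length-concatMap-children zs))

    below : concatMap children zs ⊆ atLevel (1 + i) xs
    below {u} u∈ with ∈-filter⁻ (λ v → level v ≟ 2 + i) {xs = xs} (∈-concatMap-children⁻ zs u∈)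
    ... | pu∈xs , pu≡ = ∈-filter⁺ (λ v → level v ≟ 1 + i) (closed u pu∈xs) (suc-injective pu≡)

  -- `f` is the number of levels above `i` that may still be occupied.
  bound : ∀ f i → (∀ {v} → v ∈ xs → level v ≤ f + i) →
          length (fromLevel (suc i)) ≤ vertices f (length (atLevel (suc i) xs))
  bound zero    i v≤ = ⊆⇒length≤ {ys = []} (filter⁺ _ xs!) λ v∈ →
    let v∈xs , i<v = ∈-filter⁻ (λ v → suc i ≤? level v) {xs = xs} v∈
    in contradiction (≤-trans i<v (v≤ v∈xs)) 1+n≰n
  bound (suc f) i v≤ = ≤-trans (split (suc i)) (+-monoʳ-≤ _ (≤-trans
    (bound f (suc i) λ {v} v∈ → subst (level v ≤_) (sym (+-suc f i)) (v≤ v∈))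
    (vertices-mono f (halve i))))

-- Connected complements and child-closed sets

connected⇒childClosed : ∀ {S n} → HasSize S n → InducesConnected (∁ S) → ChildClosed S
connected⇒childClosed {S} (xs , _ , _ , xs⇔S) connected v pv∈S with v ∈? xs
... | yes v∈xs = to (xs⇔S v) v∈xs
... | no  v∉xs = contradiction (level-mono (descend (connected v top v∉S top∉S) ε))
                   (<⇒≱ (s≤s (m≤m+n (level v) height)))
  where
  height : ℕ
  height = max 0 (map level xs)

  top : Vertex
  -- This level exceeds every level in `S`, so `top` lies outside `S`, and also the level of `v`, so
  -- no path confined below `v` reaches it.
  top = vertex (suc (level v + height)) 0

  v∉S : ¬ S v
  v∉S = v∉xs ∘ from (xs⇔S v)

  top∉S : ¬ S top
  top∉S top∈S = <⇒≱ (s≤s (m≤n+m height (level v)))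
    (lookup (xs≤max 0 (map level xs)) (∈-map⁺ level (from (xs⇔S top) top∈S)))

  _↑*_ : Vertex → Vertex → Set
  _↑*_ = Star λ x y → y ≡ parent x

  level-mono : ∀ {x y} → x ↑* y → level x ≤ level y
  level-mono ε            = ≤-refl
  level-mono (refl ◅ x↑y) = ≤-trans (n≤1+n _) (level-mono x↑y)

  -- A path outside S that starts at v stays below v, as it cannot use parent v.
  descend : ∀ {x y} → Star (λ x y → ¬ S x × ¬ S y × Adjacent x y) x y → x ↑* v → y ↑* v
  descend ε x↑v = x↑v
  descend ((_ , pv∉S , fwd refl) ◅ path) ε            = contradiction pv∈S pv∉S
  descend ((_ , _    , fwd refl) ◅ path) (refl ◅ y↑v) = descend path y↑v
  descend ((_ , _    , bwd x≡py) ◅ path) x↑v          = descend path (x≡py ◅ x↑v)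


-- Parents of vertices outside `S` are outside `S`, so both ends can climb until halving has made
-- their indices 0; the two climbs are then joined.
childClosed⇒connected : ∀ {S} → ChildClosed S → InducesConnected (∁ S)
childClosed⇒connected {S} closed u v u∉S v∉S =
  -- The climb from `u` counts `level v` among its steps and the climb from `v` counts `level u`, so
  -- both stop at the same level.
  climb (suc (index u + index v + level v)) u u∉S
        (≤-trans (m≤m+n _ _) (≤-trans (m≤m+n _ _) (n≤1+n _)))
        (arrive₁ (index u) (index v) (level u) (level v))
  ◅◅
  reverse (λ (x∉S , y∉S , x~y) → y∉S , x∉S , symmetric _ x~y)
    (climb (suc (index u + index v + level u)) v v∉S
           (≤-trans (m≤n+m _ (index u)) (≤-trans (m≤m+n _ _) (n≤1+n _)))
           (arrive₂ (index u) (index v) (level u) (level v)))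
  where
  climb : ∀ {k} m w → ¬ S w → index w ≤ m → suc k ≡ m + level w →
          Star (λ x y → ¬ S x × ¬ S y × Adjacent x y) w (vertex (suc k) 0)
  climb zero    (vertex i 0) _ _ refl = ε
  climb (suc m) w w∉S iw≤ e = (w∉S , w∉S ∘ closed w , fwd refl) ◅
    climb m (parent w) (w∉S ∘ closed w) (n≤1+m⇒⌊n/2⌋≤m iw≤) (trans e (sym (+-suc m (level w))))

  arrive₁ : ∀ a b c d → suc (a + b + c + d) ≡ suc (a + b + d) + c
  arrive₁ = solve-∀

  arrive₂ : ∀ a b c d → suc (a + b + c + d) ≡ suc (a + b + c) + d
  arrive₂ = solve-∀

-- Extremal sets

-- The levels are filled from the left, starting with l leaves.
fill : ∀ f l n → l ≤ n → n ≤ vertices f l →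
  ∃[ xs ] Unique xs × length xs ≡ n × ChildClosed (_∈ xs) ×
          (∀ j → vertex 1 j ∈ xs ⇔ j < l)
fill zero    .zero .zero z≤n z≤n = [] , [] , refl , (λ _ ()) , λ _ → mk⇔ (λ ()) (λ ())
-- The next level receives `⌊ l /2⌋` vertices, or all that remain if these are fewer. The recursive
-- set is then raised by one level.
fill (suc f) l n l≤n n≤ with fill f (⌊ l /2⌋ ⊓ (n ∸ l)) (n ∸ l) (m⊓n≤n _ _) rest≤
  where
  n∸l≤ : n ∸ l ≤ vertices f ⌊ l /2⌋
  n∸l≤ = ≤-trans (∸-monoˡ-≤ l n≤) (≤-reflexive (m+n∸m≡n l _))

  self : ∀ f {m l} → m ≤ vertices f l → m ≤ vertices f m
  self zero    m≤ = m≤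
  self (suc f) _  = m≤m+n _ _

  rest≤ : n ∸ l ≤ vertices f (⌊ l /2⌋ ⊓ (n ∸ l))
  rest≤ with ⊓-sel ⌊ l /2⌋ (n ∸ l)
  ... | inj₁ e = subst (λ k → n ∸ l ≤ vertices f k) (sym e) n∸l≤
  ... | inj₂ e = subst (λ k → n ∸ l ≤ vertices f k) (sym e) (self f n∸l≤)
... | ys , ys! , len , closed , leaves = xs , unique , length≡ , closed′ , λ j → mk⇔ leaf⁻ leaf⁺
  where
  leaf : ℕ → Vertex
  leaf j = vertex 1 j

  up : Vertex → Vertex
  up (vertex i j) = vertex (suc i) j

  up-injective : ∀ {u v} → up u ≡ up v → u ≡ v
  up-injective refl = refl

  xs : List Vertex
  xs = map leaf (upTo l) ++ map up ys

  ∈-up⁻ : ∀ {v} → v ∈ map up ys → 2 ≤ level v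
  ∈-up⁻ v∈ with ∈-map⁻ up v∈
  ... | u , _ , refl = s≤s (1≤level u)

  ∈-leaves⁻ : ∀ {v} → v ∈ map leaf (upTo l) → ∃[ j ] j < l × v ≡ leaf j
  ∈-leaves⁻ v∈ with ∈-map⁻ leaf v∈
  ... | j , j∈ , v≡ = j , ∈-upTo⁻ j∈ , v≡

  unique : Unique xs
  unique = ++⁺ (map⁺ (cong index) (upTo⁺ l)) (map⁺ up-injective ys!) λ (v∈leaves , v∈up) →
    let _ , _ , v≡leaf = ∈-leaves⁻ v∈leaves
    in contradiction (subst (λ v → 2 ≤ level v) v≡leaf (∈-up⁻ v∈up)) λ { (s≤s ()) }

  length≡ : length xs ≡ n
  length≡ = trans (length-++ (map leaf (upTo l)))
    (trans (cong₂ _+_ (trans (length-map leaf (upTo l)) (length-upTo l))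
                      (trans (length-map up ys) len))
           (m+[n∸m]≡n l≤n))

  leaf⁺ : ∀ {j} → j < l → leaf j ∈ xs
  leaf⁺ j<l = ∈-++⁺ˡ (∈-map⁺ leaf (∈-upTo⁺ j<l))

  leaf⁻ : ∀ {j} → leaf j ∈ xs → j < l
  leaf⁻ leaf∈ with ∈-++⁻ (map leaf (upTo l)) leaf∈
  ... | inj₁ ∈leaves with _ , j<l , refl ← ∈-leaves⁻ ∈leaves = j<l
  ... | inj₂ ∈up = contradiction (∈-up⁻ ∈up) λ { (s≤s ()) }

  down : ∀ {i j} → vertex (2 + i) j ∈ xs → vertex (1 + i) j ∈ ys
  down v∈ with ∈-++⁻ (map leaf (upTo l)) v∈
  ... | inj₁ ∈leaves with () ← proj₂ (proj₂ (∈-leaves⁻ ∈leaves))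
  ... | inj₂ ∈up with vertex _ _ , u∈ , refl ← ∈-map⁻ up ∈up = u∈

  closed′ : ChildClosed (_∈ xs)
  closed′ (vertex 0 _ {{p}}) _ = contradiction refl (≢-nonZero⁻¹ 0 {{p}})
  -- Lowered by one level, the parent is a leaf of `ys`, so `⌊ j /2⌋ < ⌊ l /2⌋`. This is why the
  -- construction also records which leaves it contains.
  closed′ (vertex 1 j) pv∈ = leaf⁺ (≰⇒> λ l≤j → <⇒≱
    (<-≤-trans (to (leaves ⌊ j /2⌋) (down pv∈)) (m⊓n≤m _ _)) (⌊n/2⌋-mono l≤j))
  closed′ (vertex (suc (suc i)) j) pv∈ = ∈-++⁺ʳ (map leaf (upTo l))
    (∈-map⁺ up (closed (vertex (suc i) j) (down pv∈)))

length-leaves : ∀ {xs l} → Unique xs → (∀ j → vertex 1 j ∈ xs ⇔ j < l) →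
                length (atLevel 1 xs) ≡ l
length-leaves {xs} {l} xs! leaves = trans
  (⊆⊇⇒length≡ (filter⁺ _ xs!) (map⁺ (cong index) (upTo⁺ l)) left right)
  (trans (length-map _ (upTo l)) (length-upTo l))
  where
  left : atLevel 1 xs ⊆ map (λ j → vertex 1 j) (upTo l)
  left {vertex i j} v∈ with ∈-filter⁻ (λ v → level v ≟ 1) {xs = xs} v∈
  ... | v∈xs , refl = ∈-map⁺ _ (∈-upTo⁺ (to (leaves j) v∈xs))

  right : map (λ j → vertex 1 j) (upTo l) ⊆ atLevel 1 xs
  right v∈ with ∈-map⁻ _ v∈
  ... | j , j∈ , refl = ∈-filter⁺ (λ v → level v ≟ 1) (from (leaves j) (∈-upTo⁻ j∈)) refl

-- The value of the minimum

-- Passing from `S` to its enumeration `xs` turns `n + k` into twice the number of leaves, and that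
-- number is at least `C n` because so many leaves admit `n` vertices.
cut-lower-bound : ∀ {S : Pred Vertex 0ℓ} {n k} → 1 ≤ n → HasSize S n → InducesConnected (∁ S) →
                  HasSize (EdgeCut S) k → C n + C n ≤ n + k
cut-lower-bound {S} {n} {k} 1≤n size@(xs , xs! , refl , xs⇔S) connected cutSize
  with closed ← connected⇒childClosed size connected
  with closed′ ← (λ v → from (xs⇔S v) ∘ closed v ∘ to (xs⇔S (parent v)))
  with cut-size xs! closed′
... | k′ , (es , es! , es-length , es⇔) , n+k′≡ =
  subst (C n + C n ≤_) (trans (sym n+k′≡) (cong (_+_ n) (hasSize-unique sizeS cutSize)))
    (+-mono-≤ C≤leaves C≤leaves)
  where
  C≤leaves : C n ≤ length (atLevel 1 xs)
  C≤leaves = proj₂ (C-leastLeaves n 1≤n) _ (length≤M-leaves xs! closed′)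

  sizeS : HasSize (EdgeCut S) k′
  sizeS = es , es! , es-length , λ e@(u , v) → mk⇔
    (λ e∈ → let u∈ , v∉ , u~v = to (es⇔ e) e∈ in to (xs⇔S u) u∈ , v∉ ∘ from (xs⇔S v) , u~v)
    (λ (u∈ , v∉ , u~v) → from (es⇔ e) (from (xs⇔S u) u∈ , v∉ ∘ to (xs⇔S v) , u~v))

theorem3p8 : (n : ℕ) → n ≥ 1 →
    ∃[ m ] IsδP n m × (+ m) ≡ (+ 2) * (+ C n) - (+ n)
theorem3p8 n n≥1
  with n≤M , _ ← C-leastLeaves n n≥1
  -- `C n` serves both as the number of leaves and as the number of levels, so the upper bound
  -- required by `fill` is `n ≤ M (C n)` by definition.
  with xs , xs! , len , closed , leaves ←
         fill (C n) (C n) n (proj₂ (C-bounds n n≥1)) n≤M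
  with k , cutSize , sum≡ ← cut-size xs! closed =
  k , (attained , minimal) , value
  where
  n+k≡2C : n + k ≡ C n + C n
  n+k≡2C = trans (cong (λ x → x + k) (sym len))
    (trans sum≡ (cong₂ _+_ (length-leaves xs! leaves) (length-leaves xs! leaves)))

  attained : ∃[ S ] HasSize S n × InducesConnected (∁ S) × HasSize (EdgeCut S) k
  attained = (_∈ xs) , (xs , xs! , len , λ _ → mk⇔ (λ z → z) (λ z → z)) ,
    childClosed⇒connected closed , cutSize

  minimal : ∀ k′ → (∃[ S ] HasSize S n × InducesConnected (∁ S) × HasSize (EdgeCut S) k′) → k ≤ k′
  minimal k′ (S , size , connected , cutSize′) = +-cancelˡ-≤ n k k′
    (≤-trans (≤-reflexive n+k≡2C) (cut-lower-bound n≥1 size connected cutSize′))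

  value : + k ≡ + 2 * + C n - + n
  value = sym (begin
    + 2 * + C n - + n      ≡⟨ cong (_- + n) (sym (pos-* 2 (C n))) ⟩
    + (2 Data.Nat.* C n) - + n
      ≡⟨ cong (λ x → + (C n + x) - + n) (+-identityʳ (C n)) ⟩
    + (C n + C n) - + n    ≡⟨ cong (λ x → + x - + n) (sym n+k≡2C) ⟩
    + (n + k) - + n        ≡⟨ m-n≡m⊖n (n + k) n ⟩
    (n + k) ⊖ n            ≡⟨ ⊖-≥ (m≤m+n n k) ⟩
    + ((n + k) ∸ n)        ≡⟨ cong +_ (m+n∸m≡n n k) ⟩
    + k                    ∎)
    where open ≡-Reasoning
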